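{- For every input sequence of requests $\sigma$ of the List Update with Time Windows problem, the algorithm ALG described in the context satisfies $$ALG(\sigma)\le 24\cdot OPT(\sigma).$$
   Context: List Update with Time Windows. A set $\mathbb{E}$ of $n$ elements is kept in an ordered list (position $1$ is the head). An input $\sigma$ is a sequence of requests $r_1,\dots,r_m$; request $r_k$ specifies an element $e_k\in\mathbb{E}$, an arrival time $a_k$ and a deadline $q_k\ge a_k$. At any time an algorithm may (a) perform an access up to position $i$, at cost $i$, which serves every pending request (arrived and not yet served) whose element currently lies in positions $1,\dots,i$; (b) swap two adjacent elements of its list at cost $1$. Actions are instantaneous (time does not advance). Every request $r_k$ must be served at some time in $[a_k,q_k]$. The cost of an algorithm on $\sigma$ is the total access cost plus the number of swaps. An online algorithm knows at time $t$ only the requests that have arrived by time $t$. $OPT(\sigma)$ denotes the minimum cost of an (offline) feasible solution; the online algorithm and $OPT$ start from the same initial list. Algorithm ALG: whenever the current time equals the deadline of at least one pending request, let the triggering element be the element at the largest current position among those elements having a pending request whose deadline is the current time, and let $i$ be its position. ALG accesses the first $\min(2i-1,n)$ positions (serving all pending requests for elements in them) and then moves the triggering element to the front of its list by $i-1$ adjacent swaps. -}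

module Defs where

open import Data.Fin.Base using (Fin; toℕ; fromℕ<)
open import Data.Fin.Permutation using (Permutation′; _⟨$⟩ʳ_; _∘ₚ_; transpose)
open import Data.Fin.Properties using (toℕ<n)
open import Data.List.Base using (List; []; _∷_; _++_; map; filter; foldl; length)
import Data.List.Extrema as Extrema
open import Data.List.Membership.Propositional using (_∈_; lose)
open import Data.List.Properties using (filter-notAll)
open import Data.List.Relation.Unary.All using (All)
open import Data.List.Relation.Unary.Any using (here; there)
open import Data.List.Relation.Unary.Linked using (Linked)
open import Data.Nat.Base using (ℕ; zero; suc; _*_; _∸_; _⊓_; _≤_; _<_)
open import Data.Nat.ListAction using (sum)
open import Data.Nat.Induction using (Acc; acc; <-wellFounded)
import Data.Nat.Properties as ℕ
open import Data.Product.Base using (Σ-syntax; _×_; _,_; proj₁; proj₂)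
open import Data.Sum.Base using (inj₁; inj₂)
open import Function.Base using (_∘_; _on_)
open import Level using (_⊔_)
open import Relation.Binary.Bundles using (DecTotalOrder)
open import Relation.Binary.PropositionalEquality using (_≡_; sym)
open import Relation.Nullary using (Dec)
open import Relation.Nullary.Decidable using (_×-dec_)
open import Relation.Unary.Properties using (∁?)

-- Time may be any decidable total order: only comparisons between times occur
-- in the problem.  The elements are `Fin n`.
module ListUpdate {c ℓ₁ ℓ₂} (Time : DecTotalOrder c ℓ₁ ℓ₂) (n : ℕ) where

  open DecTotalOrder Time using (totalOrder)
    renaming (Carrier to T; _≈_ to _≈ᵗ_; _≟_ to _≟ᵗ_; _≤_ to _≤ᵗ_; _≤?_ to _≤?ᵗ_)

  -- An ordered list is the bijection taking each element to its (0-based) index.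
  Ordering : Set
  Ordering = Permutation′ n

  position : Ordering → Fin n → ℕ
  position π e = suc (toℕ (π ⟨$⟩ʳ e))

  record Request : Set (c ⊔ ℓ₂) where
    field
      element          : Fin n
      arrival          : T
      deadline         : T
      arrival≤deadline : arrival ≤ᵗ deadline
  open Request public

  -- `access i` accesses positions 1,…,i; `swap k` exchanges the elements with
  -- 0-based indices k and k + 1.
  data Action : Set where
    access : (i : ℕ) → i ≤ n → Action
    swap   : (k : ℕ) → suc k < n → Action

  actionCost : Action → ℕ
  actionCost (access i _) = i
  actionCost (swap _ _)   = 1

  perform : Ordering → Action → Ordering
  perform π (access _ _)   = π
  perform π (swap k 1+k<n) =
    π ∘ₚ transpose (fromℕ< (ℕ.<-trans (ℕ.n<1+n k) 1+k<n)) (fromℕ< 1+k<n)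

  -- Actions with equal times are performed in the order listed.
  Schedule : Set c
  Schedule = List (T × Action)

  cost : Schedule → ℕ
  cost = sum ∘ map (actionCost ∘ proj₂)

  -- An access up to position i at time t, with the list in state π, serves r
  -- unless r has already been served.
  Reaches : T → Ordering → ℕ → Request → Set ℓ₂
  Reaches t π i r = arrival r ≤ᵗ t × position π (element r) ≤ i

  reaches? : ∀ t π i r → Dec (Reaches t π i r)
  reaches? t π i r = (arrival r ≤?ᵗ t) ×-dec (position π (element r) ℕ.≤? i)

  data ServedInTime (r : Request) : Ordering → Schedule → Set (c ⊔ ℓ₂) where
    here  : ∀ {π t i i≤n S} → Reaches t π i r → t ≤ᵗ deadline r →
            ServedInTime r π ((t , access i i≤n) ∷ S)
    there : ∀ {π t a S} → ServedInTime r (perform π a) S →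
            ServedInTime r π ((t , a) ∷ S)

  Feasible : Ordering → List Request → Schedule → Set (c ⊔ ℓ₂)
  Feasible π₀ σ S = Linked (_≤ᵗ_ on proj₁) S × All (λ r → ServedInTime r π₀ S) σ

  IsOPT : Ordering → List Request → ℕ → Set (c ⊔ ℓ₂)
  IsOPT π₀ σ opt =
    (Σ[ S ∈ Schedule ] (Feasible π₀ σ S × cost S ≡ opt)) ×
    (∀ S → Feasible π₀ σ S → opt ≤ cost S)

  -- Adjacent swaps bringing the element at index k to the front.
  toFront : (k : ℕ) → k < n → List Action
  toFront zero    _     = []
  toFront (suc k) 1+k<n = swap k 1+k<n ∷ toFront k (ℕ.<-trans (ℕ.n<1+n k) 1+k<n)

  -- One phase of ALG, from list state π with unserved requests r ∷ rs.  The next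
  -- time t at which ALG acts is the earliest deadline of an unserved request;
  -- counting requests yet to arrive is harmless, because one whose deadline is t
  -- has arrived by t.
  module Step (π : Ordering) (r : Request) (rs : List Request) where

    next : Request
    next = Extrema.argmin totalOrder deadline r rs

    t : T
    t = deadline next

    due : List Request
    due = filter (λ r′ → (arrival r′ ≤?ᵗ t) ×-dec (deadline r′ ≟ᵗ t)) (r ∷ rs)

    -- `next` itself is due, so starting the maximum from it adds nothing.
    trigger : Fin n
    trigger = Extrema.argmax ℕ.≤-totalOrder (position π) (element next) (map element due)

    i : ℕ
    i = position π trigger

    reach : ℕ
    reach = (2 * i ∸ 1) ⊓ n

    actions : List Action
    actions = access reach (ℕ.m⊓n≤n (2 * i ∸ 1) n) ∷
              toFront (toℕ (π ⟨$⟩ʳ trigger)) (toℕ<n (π ⟨$⟩ʳ trigger))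

    π′ : Ordering
    π′ = foldl perform π actions

    unserved : List Request
    unserved = filter (∁? (reaches? t π reach)) (r ∷ rs)

    next-∈ : next ∈ r ∷ rs
    next-∈ with Extrema.argmin-sel totalOrder deadline r rs
    ... | inj₁ next≡r  = here next≡r
    ... | inj₂ next∈rs = there next∈rs

    i≤reach : i ≤ reach
    i≤reach = ℕ.⊓-glb i≤2i∸1 (toℕ<n (π ⟨$⟩ʳ trigger))
      where
      i≤2i∸1 : i ≤ 2 * i ∸ 1
      i≤2i∸1 = ℕ.≤-trans (ℕ.m≤m+n i _) (ℕ.≤-reflexive (sym (ℕ.+-suc _ _)))

    next-reached : Reaches t π reach next
    next-reached =
      arrival≤deadline next ,
      ℕ.≤-trans (Extrema.f[⊥]≤f[argmax] ℕ.≤-totalOrder {f = position π} (element next) (map element due)) i≤reach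

    unserved-< : length unserved < length (r ∷ rs)
    unserved-< = filter-notAll (∁? (reaches? t π reach)) (r ∷ rs)
      (lose next-∈ (λ ¬reached → ¬reached next-reached))

  runFrom : Ordering → (us : List Request) → Acc _<_ (length us) → Schedule
  runFrom π []       _         = []
  runFrom π (r ∷ rs) (acc rec) = map (t ,_) actions ++ runFrom π′ unserved (rec unserved-<)
    where open Step π r rs

  run : Ordering → List Request → Schedule
  run π₀ σ = runFrom π₀ σ (<-wellFounded (length σ))

  ALG : Ordering → List Request → ℕ
  ALG π₀ σ = cost (run π₀ σ)

{-# OPTIONS --safe #-}
module Submission where

-- Amortise against a fixed feasible schedule.  Let A and O be the current lists of
-- ALG and of that schedule, and let a snapshot of each element e record O when the
-- schedule last reached e by an access or ALG last moved e, whichever is later.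
-- The potential is six times the number of inversions between A and O, plus twelve
-- per pair (x , y) such that x has overtaken y in O since the snapshot of y, plus a
-- credit for every access of the schedule.  A swap of the schedule raises this by
-- at most 6 + 12.
--
-- Suppose ALG is triggered by e at position i.  The schedule has already served the
-- triggering request; let j be its last access reaching e.  Every element ahead of
-- e in A was, at that access, either behind e in O, and then it releases potential
-- 6 now, or among the fewer than j elements ahead of e.  So the phase costs at most
-- min(9i, 12j − 3i) after the release.  Since ALG serves the first 2i − 1
-- positions, the next phase accounted to the same access has position at least 2i,
-- and the sum of these bounds over positions that double is at most 24j.

import Algebra.Properties.Semiring.Sum
open import Data.Bool.Base using (if_then_else_)
open import Data.Fin.Base using (Fin; zero; suc; toℕ; fromℕ<)
open import Data.Fin.Permutation using (Permutation′; _⟨$⟩ʳ_; _⟨$⟩ˡ_; inverseˡ)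
open import Data.Fin.Properties using (_≟_; toℕ<n; toℕ-fromℕ<; toℕ-injective)
open import Data.List.Base using (List; []; _∷_; _++_; map; foldl; length)
open import Data.List.Membership.Propositional using (_∈_)
open import Data.List.Membership.Propositional.Properties using (∈-filter⁻; ∈-map⁻)
open import Data.List.Properties using (map-++)
open import Data.List.Relation.Unary.All as All using (All; []; _∷_)
open import Data.List.Relation.Unary.Any using (here; there)
open import Data.List.Relation.Unary.Linked as Linked using (Linked; _∷_)
import Data.List.Extrema as Extrema
open import Data.Nat.Base using (ℕ; zero; suc; _+_; _*_; _∸_; _⊔_; _≤_; _<_; z≤n; s≤s; z<s)
import Data.Nat.ListAction as ListAction
open import Data.Nat.ListAction.Properties using (sum-++)
open import Data.Nat.Induction using (Acc; acc; <-wellFounded)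
import Data.Nat.Properties as ℕ
open import Data.Nat.Tactic.RingSolver using (solve-∀)
open import Data.Product.Base using (Σ-syntax; _×_; _,_; proj₁; proj₂)
open import Data.Sum.Base using (_⊎_; inj₁; inj₂; [_,_]′)
open import Data.Vec.Functional using (Vector; updateAt) renaming (_∷_ to _◂_)
open import Data.Vec.Functional.Properties using (updateAt-updates; updateAt-minimal)
open import Function.Base using (_∘_; _on_; const; case_of_)
open import Level using () renaming (_⊔_ to _⊔ˡ_)
open import Relation.Binary.Bundles using (DecTotalOrder)
open import Relation.Binary.Definitions using (tri<; tri≈; tri>)
open import Relation.Binary.PropositionalEquality
open import Relation.Nullary using (Dec; yes; no; does; ¬_; contradiction)
open import Relation.Nullary.Decidable using (dec-true; dec-false; toSum; _×-dec_)
open import Relation.Unary.Properties using (∁?)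
open import Defs

open Algebra.Properties.Semiring.Sum ℕ.+-*-semiring
  using (sum; ∑-distrib-+; sum-cong-≗; sum-permute; sum-replicate-zero; *-distribˡ-sum)

-- Finite sums and indicators.

infixr 6.5 ∑-syntax

∑-syntax : ∀ n → Vector ℕ n → ℕ
∑-syntax _ = sum

syntax ∑-syntax n (λ x → t) = ∑[ x < n ] t

∑-mono : ∀ {n} {f g : Fin n → ℕ} → (∀ x → f x ≤ g x) → sum f ≤ sum g
∑-mono {zero}  f≤g = z≤n
∑-mono {suc n} f≤g = ℕ.+-mono-≤ (f≤g zero) (∑-mono (f≤g ∘ suc))

if-yes : ∀ {p a} {P : Set p} {A : Set a} {x y : A} (P? : Dec P) → P → (if does P? then x else y) ≡ x
if-yes P? p = cong (if_then _ else _) (dec-true P? p)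

if-no : ∀ {p a} {P : Set p} {A : Set a} {x y : A} (P? : Dec P) → ¬ P → (if does P? then x else y) ≡ y
if-no P? ¬p = cong (if_then _ else _) (dec-false P? ¬p)

𝟙 : ∀ {p} {P : Set p} → Dec P → ℕ
𝟙 P? = if does P? then 1 else 0

𝟙≤ : ∀ {p m} {P : Set p} (P? : Dec P) → (P → 1 ≤ m) → 𝟙 P? ≤ m
𝟙≤ (yes p) f = f p
𝟙≤ (no _)  f = z≤n

𝟙-mono : ∀ {p q} {P : Set p} {Q : Set q} (P? : Dec P) (Q? : Dec Q) → (P → Q) → 𝟙 P? ≤ 𝟙 Q?
𝟙-mono P? Q? f = 𝟙≤ P? (ℕ.≤-reflexive ∘ sym ∘ if-yes Q? ∘ f)

∑-select : ∀ {n} (e : Fin n) (f : Fin n → ℕ) → ∑[ x < n ] 𝟙 (x ≟ e) * f x ≡ f e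
∑-select {suc n} zero    f = begin
  1 * f zero + sum {n} (const 0)  ≡⟨ cong₂ _+_ (ℕ.*-identityˡ (f zero)) (sum-replicate-zero n) ⟩
  f zero + 0                      ≡⟨ ℕ.+-identityʳ _ ⟩
  f zero                          ∎
  where open ≡-Reasoning
∑-select {suc n} (suc e) f = ∑-select e (f ∘ suc)

∑-count-below : ∀ {n k} → k ≤ n → ∑[ x < n ] 𝟙 (toℕ x ℕ.<? k) ≡ k
∑-count-below {n}     z≤n       = sum-replicate-zero n
∑-count-below {suc n} (s≤s k≤n) = cong suc (∑-count-below k≤n)

-- For double sums that change only in row and column `e`: column `e` may lose `g` and row `e` may
-- gain `h`. The indicators spread these amounts over all pairs, so one pointwise comparison
-- suffices.
∑∑-exchange : ∀ {n} (F F′ : Fin n → Fin n → ℕ) (g h : Fin n → ℕ) (e : Fin n) →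
  (∀ x y → F′ x y + 𝟙 (y ≟ e) * g x ≤ F x y + 𝟙 (x ≟ e) * h y) →
  ∑[ x < n ] ∑[ y < n ] F′ x y + sum g ≤ ∑[ x < n ] ∑[ y < n ] F x y + sum h
∑∑-exchange {n} F F′ g h e le = begin
  ∑[ x < n ] ∑[ y < n ] F′ x y + sum g
    ≡⟨ cong (_ +_) (sum-cong-≗ (λ x → ∑-select e (const (g x)))) ⟨
  ∑[ x < n ] ∑[ y < n ] F′ x y + ∑[ x < n ] ∑[ y < n ] 𝟙 (y ≟ e) * g x
    ≡⟨ ∑∑-distrib F′ _ ⟨
  ∑[ x < n ] ∑[ y < n ] (F′ x y + 𝟙 (y ≟ e) * g x)
    ≤⟨ ∑-mono (λ x → ∑-mono (le x)) ⟩
  ∑[ x < n ] ∑[ y < n ] (F x y + 𝟙 (x ≟ e) * h y)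
    ≡⟨ ∑∑-distrib F _ ⟩
  ∑[ x < n ] ∑[ y < n ] F x y + ∑[ x < n ] ∑[ y < n ] 𝟙 (x ≟ e) * h y
    ≡⟨ cong (_ +_) (sum-cong-≗ (λ x → *-distribˡ-sum (𝟙 (x ≟ e)) h)) ⟨
  ∑[ x < n ] ∑[ y < n ] F x y + ∑[ x < n ] 𝟙 (x ≟ e) * sum h
    ≡⟨ cong (_ +_) (∑-select e (const (sum h))) ⟩
  ∑[ x < n ] ∑[ y < n ] F x y + sum h ∎
  where
  open ℕ.≤-Reasoning
  ∑∑-distrib : ∀ (G H : Fin n → Fin n → ℕ) →
    ∑[ x < n ] ∑[ y < n ] (G x y + H x y) ≡ ∑[ x < n ] ∑[ y < n ] G x y + ∑[ x < n ] ∑[ y < n ] H x y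
  ∑∑-distrib G H = trans (sum-cong-≗ (λ x → ∑-distrib-+ (G x) (H x))) (∑-distrib-+ (sum ∘ G) (sum ∘ H))

-- The old and the new value are added on opposite sides so that no truncated subtraction occurs.
∑-updateAt : ∀ {a} {A : Set a} {m} (f : A → ℕ) (v : Vector A m) (k : Fin m) (b : A) →
  ∑[ x < m ] f (updateAt v k (const b) x) + f (v k) ≡ ∑[ x < m ] f (v x) + f b
∑-updateAt f v zero    b = swap-outer (f b) _ (f (v zero))
  where
  swap-outer : ∀ x y z → x + y + z ≡ z + y + x
  swap-outer = solve-∀
∑-updateAt f v (suc k) b = begin
  f (v zero) + _ + f (v (suc k))    ≡⟨ ℕ.+-assoc (f (v zero)) _ _ ⟩
  f (v zero) + (_ + f (v (suc k)))  ≡⟨ cong (f (v zero) +_) (∑-updateAt f (v ∘ suc) k b) ⟩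
  f (v zero) + (_ + f b)            ≡⟨ ℕ.+-assoc (f (v zero)) _ _ ⟨
  f (v zero) + _ + f b              ∎
  where open ≡-Reasoning

-- Inversions, overtakings and the potential `Ψ`.

module _ {n : ℕ} where

  index : Permutation′ n → Fin n → ℕ
  index π x = toℕ (π ⟨$⟩ʳ x)

  index-injective : ∀ π {x y} → index π x ≡ index π y → x ≡ y
  index-injective π eq =
    trans (sym (inverseˡ π)) (trans (cong (π ⟨$⟩ˡ_) (toℕ-injective eq)) (inverseˡ π))

  before : Permutation′ n → Fin n → Fin n → ℕ
  before π x y = 𝟙 (index π x ℕ.<? index π y)

  before≤1 : ∀ π x y → before π x y ≤ 1
  before≤1 π x y = 𝟙≤ (index π x ℕ.<? index π y) (const ℕ.≤-refl)

  before-irrefl : ∀ π x → before π x x ≡ 0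
  before-irrefl π x = if-no (index π x ℕ.<? index π x) (ℕ.<-irrefl refl)

  -- Both indicators are recorded as numerals, so that rewriting with them evaluates the products in
  -- the potential.
  data Compared (π : Permutation′ n) (x y : Fin n) : Set where
    precedes : before π x y ≡ 1 → before π y x ≡ 0 → Compared π x y
    follows  : before π x y ≡ 0 → before π y x ≡ 1 → Compared π x y

  compare : ∀ π {x y} → x ≢ y → Compared π x y
  compare π {x} {y} x≢y with ℕ.<-cmp (index π x) (index π y)
  ... | tri< x<y _ y≮x = precedes (if-yes (_ ℕ.<? _) x<y) (if-no (_ ℕ.<? _) y≮x)
  ... | tri≈ _ x≈y _   = contradiction (index-injective π x≈y) x≢y
  ... | tri> x≮y _ y<x = follows (if-no (_ ℕ.<? _) x≮y) (if-yes (_ ℕ.<? _) y<x)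

  before-asym : ∀ π x y → before π x y * before π y x ≡ 0
  before-asym π x y with x ≟ y
  ... | yes refl rewrite before-irrefl π x = refl
  ... | no x≢y with compare π x≢y
  ...   | precedes p q rewrite p | q = refl
  ...   | follows p q rewrite p = refl

  -- Reindexing along the bijection `π` turns the sum into a count of the indices below `index π e`.
  ∑-before : ∀ π e → ∑[ x < n ] before π x e ≡ index π e
  ∑-before π e =
    trans (sym (sum-permute (λ z → 𝟙 (toℕ z ℕ.<? index π e)) π)) (∑-count-below (ℕ.<⇒≤ (toℕ<n _)))

  inversions : Permutation′ n → Permutation′ n → ℕ
  inversions π ρ = ∑[ x < n ] ∑[ y < n ] before π x y * before ρ y x

  -- The number of overtakings: x is now ahead of y in ρ, but was behind it when
  -- the snapshot of y was taken.
  overtakings : Permutation′ n → (Fin n → Permutation′ n) → ℕ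
  overtakings ρ σ = ∑[ x < n ] ∑[ y < n ] before ρ x y * before (σ y) y x

  inversions-refl : ∀ π → inversions π π ≡ 0
  inversions-refl π =
    trans (sum-cong-≗ (λ x → trans (sum-cong-≗ (before-asym π x)) (sum-replicate-zero n)))
          (sum-replicate-zero n)

  -- π′ arises from π by moving e to the front.
  record Fronted (π π′ : Permutation′ n) (e : Fin n) : Set where
    field
      at-front : index π′ e ≡ 0
      delays   : ∀ x → x ≢ e → index π x ≤ index π′ x
      reflects : ∀ x y → x ≢ e → y ≢ e → index π′ x < index π′ y → index π x < index π y

  Ψ : Permutation′ n → Permutation′ n → (Fin n → Permutation′ n) → ℕ
  Ψ π ρ σ = 6 * (inversions π ρ + 2 * overtakings ρ σ)

  module _ {π π′ : Permutation′ n} {e : Fin n} (fr : Fronted π π′ e) (ρ : Permutation′ n) where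
    open Fronted fr

    before-front : ∀ x → before π′ x e ≡ 0
    before-front x rewrite at-front = refl

    -- Only pairs containing `e` are affected. An element ahead of `e` in `π` loses its inversion
    -- with `e` if it is behind `e` in `ρ`, and gains one if it is ahead of `e` there.
    inversions-front :
      inversions π′ ρ + ∑[ x < n ] before π x e * before ρ e x ≤
      inversions π ρ + ∑[ x < n ] before π x e * before ρ x e
    inversions-front = ∑∑-exchange _ _ _ _ e pointwise
      where
      pointwise : ∀ x y →
        before π′ x y * before ρ y x + 𝟙 (y ≟ e) * (before π x e * before ρ e x) ≤
        before π x y * before ρ y x + 𝟙 (x ≟ e) * (before π y e * before ρ y e)
      pointwise x y with y ≟ e | x ≟ e
      ... | yes refl | yes refl rewrite before-irrefl π e | before-irrefl π′ e = z≤n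
      ... | yes refl | no x≢e rewrite before-front x | ℕ.+-identityʳ (before π x e * before ρ e x)
          = ℕ.≤-refl
      ... | no y≢e | no x≢e =
        ℕ.+-monoˡ-≤ 0 (ℕ.*-monoˡ-≤ (before ρ y x) (𝟙-mono (_ ℕ.<? _) (_ ℕ.<? _) (reflects x y x≢e y≢e)))
      ... | no y≢e | yes refl with compare π y≢e
      ...   | precedes p q rewrite p | q
            = ℕ.+-mono-≤ (ℕ.*-monoˡ-≤ (before ρ y e) (before≤1 π′ e y)) z≤n
      ...   | follows p q rewrite p | q
            = ℕ.+-monoˡ-≤ 0 (ℕ.*-monoˡ-≤ (before ρ y e) (before≤1 π′ e y))

  -- Against a snapshot equal to `ρ` itself nothing has overtaken `e`, so every term of column `e`
  -- is released.
  overtakings-refresh : ∀ ρ σ e →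
    overtakings ρ (updateAt σ e (const ρ)) + ∑[ x < n ] before ρ x e * before (σ e) e x ≤ overtakings ρ σ
  overtakings-refresh ρ σ e =
    ℕ.≤-trans (∑∑-exchange _ _ _ (const 0) e pointwise)
              (ℕ.≤-reflexive (trans (cong (overtakings ρ σ +_) (sum-replicate-zero n)) (ℕ.+-identityʳ _)))
    where
    pointwise : ∀ x y →
      before ρ x y * before (updateAt σ e (const ρ) y) y x + 𝟙 (y ≟ e) * (before ρ x e * before (σ e) e x) ≤
      before ρ x y * before (σ y) y x + 𝟙 (x ≟ e) * 0
    pointwise x y with y ≟ e
    ... | yes refl rewrite updateAt-updates e {const ρ} σ | before-asym ρ x e
                         | ℕ.*-identityˡ (before ρ x e * before (σ e) e x) = ℕ.m≤m+n _ _
    ... | no y≢e rewrite updateAt-minimal y e {const ρ} σ y≢e = ℕ.+-monoʳ-≤ _ z≤n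

  -- Each `x` ahead of `e` in `π` must release one unit. If it is behind `e` in `ρ`, the vanishing
  -- inversion supplies it. Otherwise a new inversion makes the need two units: an overtaking of `e`
  -- by `x` supplies both, which is why overtakings weigh double, or else `x` was already ahead in
  -- the snapshot and is counted in `kept`.
  Ψ-front : ∀ {π π′ e} → Fronted π π′ e → ∀ ρ σ →
    Ψ π′ ρ (updateAt σ e (const ρ)) + 6 * index π e ≤
    Ψ π ρ σ + 12 * (∑[ x < n ] before π x e * before (σ e) x e)
  Ψ-front {π} {π′} {e} fr ρ σ =
    combine (inversions π′ ρ) (inversions π ρ) (overtakings ρ (updateAt σ e (const ρ))) (overtakings ρ σ)
      behind ahead passed kept (index π e) (inversions-front fr ρ) (overtakings-refresh ρ σ e) column
    where
    behind = ∑[ x < n ] before π x e * before ρ e x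
    ahead  = ∑[ x < n ] before π x e * before ρ x e
    passed = ∑[ x < n ] before ρ x e * before (σ e) e x
    kept   = ∑[ x < n ] before π x e * before (σ e) x e

    pointwise : ∀ x →
      before π x e * before ρ x e + before π x e ≤
      before π x e * before ρ e x + 2 * (before ρ x e * before (σ e) e x + before π x e * before (σ e) x e)
    pointwise x with x ≟ e
    ... | yes refl rewrite before-irrefl π e = z≤n
    ... | no x≢e with compare π x≢e | compare ρ x≢e | compare (σ e) x≢e
    ...   | follows p _ | _      | _      rewrite p = z≤n
    ...   | precedes p _ | follows q r | _      rewrite p | q | r = s≤s z≤n
    ...   | precedes p _ | precedes q r | precedes s t rewrite p | q | r | s | t = ℕ.≤-refl
    ...   | precedes p _ | precedes q r | follows s t rewrite p | q | r | s | t = ℕ.≤-refl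

    column : ahead + index π e ≤ behind + 2 * (passed + kept)
    column = begin
      ahead + index π e
        ≡⟨ cong (ahead +_) (∑-before π e) ⟨
      ahead + ∑[ x < n ] before π x e
        ≡⟨ ∑-distrib-+ {n} _ _ ⟨
      ∑[ x < n ] (before π x e * before ρ x e + before π x e)
        ≤⟨ ∑-mono pointwise ⟩
      ∑[ x < n ] (before π x e * before ρ e x
                  + 2 * (before ρ x e * before (σ e) e x + before π x e * before (σ e) x e))
        ≡⟨ ∑-distrib-+ {n} _ _ ⟩
      behind + ∑[ x < n ] 2 * (before ρ x e * before (σ e) e x + before π x e * before (σ e) x e)
        ≡⟨ cong (behind +_) (*-distribˡ-sum {n} 2 _) ⟨
      behind + 2 * (∑[ x < n ] (before ρ x e * before (σ e) e x + before π x e * before (σ e) x e))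
        ≡⟨ cong (λ s → behind + 2 * s) (∑-distrib-+ {n} _ _) ⟩
      behind + 2 * (passed + kept) ∎
      where open ℕ.≤-Reasoning

    combine : ∀ I′ I D′ D b a p k i → I′ + b ≤ I + a → D′ + p ≤ D → a + i ≤ b + 2 * (p + k) →
      6 * (I′ + 2 * D′) + 6 * i ≤ 6 * (I + 2 * D) + 12 * k
    combine I′ I D′ D b a p k i h₁ h₂ h₃ = begin
      6 * (I′ + 2 * D′) + 6 * i        ≡⟨ lhs I′ D′ i ⟩
      6 * (I′ + 2 * D′ + i)            ≤⟨ ℕ.*-monoʳ-≤ 6 (ℕ.+-cancelʳ-≤ (b + a + 2 * p) (I′ + 2 * D′ + i) (I + 2 * D + 2 * k) total) ⟩
      6 * (I + 2 * D + 2 * k)          ≡⟨ rhs I D k ⟩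
      6 * (I + 2 * D) + 12 * k         ∎
      where
      open ℕ.≤-Reasoning
      lhs : ∀ x y z → 6 * (x + 2 * y) + 6 * z ≡ 6 * (x + 2 * y + z)
      lhs = solve-∀
      rhs : ∀ x y z → 6 * (x + 2 * y + 2 * z) ≡ 6 * (x + 2 * y) + 12 * z
      rhs = solve-∀
      e₁ : ∀ I′ D′ b a p i → I′ + 2 * D′ + i + (b + a + 2 * p) ≡ (I′ + b) + 2 * (D′ + p) + (a + i)
      e₁ = solve-∀
      e₂ : ∀ I D b a p k → (I + a) + 2 * D + (b + 2 * (p + k)) ≡ I + 2 * D + 2 * k + (b + a + 2 * p)
      e₂ = solve-∀
      -- This is `h₁` plus twice `h₂` plus `h₃`, with the terms to be cancelled collected on the
      -- right.
      total : I′ + 2 * D′ + i + (b + a + 2 * p) ≤ I + 2 * D + 2 * k + (b + a + 2 * p)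
      total = begin
        I′ + 2 * D′ + i + (b + a + 2 * p)      ≡⟨ e₁ I′ D′ b a p i ⟩
        (I′ + b) + 2 * (D′ + p) + (a + i)      ≤⟨ ℕ.+-mono-≤ (ℕ.+-mono-≤ h₁ (ℕ.*-monoʳ-≤ 2 h₂)) h₃ ⟩
        (I + a) + 2 * D + (b + 2 * (p + k))    ≡⟨ e₂ I D b a p k ⟩
        I + 2 * D + 2 * k + (b + a + 2 * p)    ∎

  -- A renewed snapshot of `y` agrees with `ρ`, and then no `x` can be ahead of `y` in one and
  -- behind it in the other.
  Ψ-snapshot : ∀ π ρ {σ σ′} → (∀ y → σ′ y ≡ ρ ⊎ σ′ y ≡ σ y) → Ψ π ρ σ′ ≤ Ψ π ρ σ
  Ψ-snapshot π ρ {σ} {σ′} renewed =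
    ℕ.*-monoʳ-≤ 6 (ℕ.+-monoʳ-≤ (inversions π ρ) (ℕ.*-monoʳ-≤ 2 (∑-mono (λ x → ∑-mono (pointwise x)))))
    where
    pointwise : ∀ x y → before ρ x y * before (σ′ y) y x ≤ before ρ x y * before (σ y) y x
    pointwise x y with renewed y
    ... | inj₁ eq rewrite eq | before-asym ρ x y = z≤n
    ... | inj₂ eq rewrite eq = ℕ.≤-refl

  Ψ-refl : ∀ π → Ψ π π (const π) ≡ 0
  Ψ-refl π rewrite inversions-refl π = refl

  -- If only `u` can newly get ahead of `v`, at most one inversion and one overtaking arise, which
  -- costs `6 * (1 + 2 * 1)`.
  Ψ-overtake : ∀ π ρ ρ′ σ u v → (∀ x y → before ρ′ x y ≤ before ρ x y + 𝟙 (x ≟ u) * 𝟙 (y ≟ v)) →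
    Ψ π ρ′ σ ≤ 18 + Ψ π ρ σ
  Ψ-overtake π ρ ρ′ σ u v le = begin
    6 * (inversions π ρ′ + 2 * overtakings ρ′ σ)
      ≤⟨ ℕ.*-monoʳ-≤ 6 (ℕ.+-mono-≤ inv (ℕ.*-monoʳ-≤ 2 ovt)) ⟩
    6 * (inversions π ρ + 1 + 2 * (overtakings ρ σ + 1))
      ≡⟨ regroup (inversions π ρ) (overtakings ρ σ) ⟩
    18 + 6 * (inversions π ρ + 2 * overtakings ρ σ) ∎
    where
    open ℕ.≤-Reasoning
    regroup : ∀ x y → 6 * (x + 1 + 2 * (y + 1)) ≡ 18 + 6 * (x + 2 * y)
    regroup = solve-∀

    exchange : ∀ (F F′ : Fin n → Fin n → ℕ) a b → (∀ x y → F′ x y ≤ F x y + 𝟙 (x ≟ a) * 𝟙 (y ≟ b)) →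
      ∑[ x < n ] ∑[ y < n ] F′ x y ≤ ∑[ x < n ] ∑[ y < n ] F x y + 1
    exchange F F′ a b le′ = begin
      ∑[ x < n ] ∑[ y < n ] F′ x y
        ≤⟨ ℕ.m≤m+n _ _ ⟩
      ∑[ x < n ] ∑[ y < n ] F′ x y + sum {n} (const 0)
        ≤⟨ ∑∑-exchange F F′ (const 0) (λ y → 𝟙 (y ≟ b)) a
             (λ x y → ℕ.≤-trans (ℕ.≤-reflexive (trans (cong (F′ x y +_) (ℕ.*-zeroʳ (𝟙 (y ≟ a)))) (ℕ.+-identityʳ _)))
                                (le′ x y)) ⟩
      ∑[ x < n ] ∑[ y < n ] F x y + ∑[ y < n ] 𝟙 (y ≟ b)
        ≡⟨ cong (_ +_) (trans (sum-cong-≗ {n} (λ y → sym (ℕ.*-identityʳ (𝟙 (y ≟ b))))) (∑-select b (const 1))) ⟩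
      ∑[ x < n ] ∑[ y < n ] F x y + 1 ∎

    scale : ∀ b b′ c {d} → d ≤ 1 → b′ ≤ b + c → b′ * d ≤ b * d + c
    scale b b′ c {d} d≤1 h = begin
      b′ * d         ≤⟨ ℕ.*-monoˡ-≤ d h ⟩
      (b + c) * d    ≡⟨ ℕ.*-distribʳ-+ d b c ⟩
      b * d + c * d  ≤⟨ ℕ.+-monoʳ-≤ (b * d) (ℕ.≤-trans (ℕ.*-monoʳ-≤ c d≤1) (ℕ.≤-reflexive (ℕ.*-identityʳ c))) ⟩
      b * d + c      ∎

    inv : inversions π ρ′ ≤ inversions π ρ + 1
    -- `inversions` evaluates `ρ` at the reversed pair, so the new inversion is the pair of `v` and
    -- `u`.
    inv = exchange _ _ v u (λ x y →
      subst₂ _≤_ (ℕ.*-comm (before ρ′ y x) (before π x y))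
        (cong₂ _+_ (ℕ.*-comm (before ρ y x) (before π x y)) (ℕ.*-comm (𝟙 (y ≟ u)) (𝟙 (x ≟ v))))
        (scale (before ρ y x) (before ρ′ y x) (𝟙 (y ≟ u) * 𝟙 (x ≟ v)) (before≤1 π x y) (le y x)))

    ovt : overtakings ρ′ σ ≤ overtakings ρ σ + 1
    ovt = exchange _ _ u v (λ x y →
      scale (before ρ x y) (before ρ′ x y) (𝟙 (x ≟ u) * 𝟙 (y ≟ v)) (before≤1 (σ y) y x) (le x y))

-- Arithmetic of the credit.

-- The credit of an access up to position j when the requests accounted to it lie
-- at positions ≥ m of the list of ALG: it bounds the sum of min(9i, 12j − 3i)
-- over sequences of positions i ≥ m that at least double at each step.
φ : ℕ → ℕ → ℕ
φ j m = (24 * j ∸ 9 * m) ⊔ (12 * j ∸ 3 * m)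

-- Here `a` is the 0-based index of the triggering element. A phase costs at most `1 + 3 * a` and
-- releases `6 * a` against `12 * p`, so `1 + 12 * p` remains to be paid from `3 * a` and the drop
-- in credit as the barrier rises to `2 * suc a`. Each branch of the new maximum is bounded
-- separately: `p ≤ a` handles the first and `p < j` the second.
φ-pays : ∀ {j m a p} → m ≤ suc a → p ≤ a → p < j →
  1 + 12 * p + φ j (2 * suc a) ≤ 3 * a + φ j m
φ-pays {j} {m} {a} {p} m≤1+a p≤a p<j =
  subst (_≤ R) (sym (ℕ.+-distribˡ-⊔ (1 + 12 * p) _ _)) (ℕ.⊔-lub
    (monus base case₂₄)
    (monus base case₁₂))
  where
  open ℕ.≤-Reasoning
  R = 3 * a + φ j m

  -- The bound `k ≤ R` covers the case where the subtraction truncates to zero.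
  monus : ∀ {k u v} → k ≤ R → k + u ≤ R + v → k + (u ∸ v) ≤ R
  monus {k} {u} {v} k≤R h with ℕ.≤-total u v
  ... | inj₁ u≤v rewrite ℕ.m≤n⇒m∸n≡0 u≤v | ℕ.+-identityʳ k = k≤R
  ... | inj₂ v≤u = ℕ.+-cancelʳ-≤ v _ _ (begin
    k + (u ∸ v) + v    ≡⟨ ℕ.+-assoc k _ v ⟩
    k + (u ∸ v + v)    ≡⟨ cong (k +_) (ℕ.m∸n+n≡m v≤u) ⟩
    k + u              ≤⟨ h ⟩
    R + v              ∎)

  12j≤ : 12 * j ≤ R + 3
  12j≤ = begin
    12 * j                            ≤⟨ ℕ.m≤n+m∸n (12 * j) (3 * m) ⟩
    3 * m + (12 * j ∸ 3 * m)          ≤⟨ ℕ.+-mono-≤ (ℕ.*-monoʳ-≤ 3 m≤1+a) (ℕ.m≤n⊔m _ _) ⟩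
    3 * suc a + φ j m                 ≡⟨ eq a (φ j m) ⟩
    R + 3                             ∎
    where
    eq : ∀ a f → 3 * (1 + a) + f ≡ 3 * a + f + 3
    eq = solve-∀

  24j≤ : 24 * j ≤ R + (6 * a + 9)
  24j≤ = begin
    24 * j                            ≤⟨ ℕ.m≤n+m∸n (24 * j) (9 * m) ⟩
    9 * m + (24 * j ∸ 9 * m)          ≤⟨ ℕ.+-mono-≤ (ℕ.*-monoʳ-≤ 9 m≤1+a) (ℕ.m≤m⊔n _ _) ⟩
    9 * suc a + φ j m                 ≡⟨ eq a (φ j m) ⟩
    R + (6 * a + 9)                   ∎
    where
    eq : ∀ a f → 9 * (1 + a) + f ≡ 3 * a + f + (6 * a + 9)
    eq = solve-∀

  12+12p≤12j : 12 + 12 * p ≤ 12 * j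
  12+12p≤12j = ℕ.≤-trans (ℕ.≤-reflexive (sym (ℕ.*-suc 12 p))) (ℕ.*-monoʳ-≤ 12 p<j)

  base : 1 + 12 * p ≤ R
  base = ℕ.+-cancelʳ-≤ 3 _ _ (begin
    1 + 12 * p + 3    ≡⟨ ℕ.+-comm _ 3 ⟩
    4 + 12 * p        ≤⟨ ℕ.+-monoˡ-≤ (12 * p) (ℕ.m≤m+n 4 8) ⟩
    12 + 12 * p       ≤⟨ 12+12p≤12j ⟩
    12 * j            ≤⟨ 12j≤ ⟩
    R + 3             ∎)

  case₂₄ : 1 + 12 * p + 24 * j ≤ R + 9 * (2 * suc a)
  case₂₄ = begin
    1 + 12 * p + 24 * j
      ≤⟨ ℕ.+-mono-≤ (ℕ.+-mono-≤ (ℕ.m≤m+n 1 8) (ℕ.*-monoʳ-≤ 12 p≤a)) 24j≤ ⟩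
    9 + 12 * a + (R + (6 * a + 9))
      ≡⟨ eq a R ⟩
    R + 9 * (2 * suc a) ∎
    where
    eq : ∀ a r → 9 + 12 * a + (r + (6 * a + 9)) ≡ r + 9 * (2 * (1 + a))
    eq = solve-∀

  case₁₂ : 1 + 12 * p + 12 * j ≤ R + 3 * (2 * suc a)
  case₁₂ = ℕ.+-cancelʳ-≤ 3 _ _ (begin
    1 + 12 * p + 12 * j + 3        ≡⟨ ℕ.+-comm _ 3 ⟩
    4 + 12 * p + 12 * j            ≤⟨ ℕ.+-monoˡ-≤ (12 * j) (ℕ.+-monoˡ-≤ (12 * p) (ℕ.m≤m+n 4 8)) ⟩
    12 + 12 * p + 12 * j           ≤⟨ ℕ.+-monoˡ-≤ (12 * j) 12+12p≤12j ⟩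
    12 * j + 12 * j                ≡⟨ eq₁ j ⟩
    24 * j                         ≤⟨ 24j≤ ⟩
    R + (6 * a + 9)                ≡⟨ eq₂ a R ⟩
    R + 3 * (2 * suc a) + 3        ∎)
    where
    eq₁ : ∀ j → 12 * j + 12 * j ≡ 24 * j
    eq₁ = solve-∀
    eq₂ : ∀ a r → r + (6 * a + 9) ≡ r + 3 * (2 * (1 + a)) + 3
    eq₂ = solve-∀

-- The accounting of one phase of cost `c₀`: `f₁` and `f₂` are the credit of the charged account
-- before and after. Adding the four hypotheses and cancelling common terms gives the amortised
-- bound.
balance : ∀ c₀ Ψ₁ Ψ₂ C₁ C₂ a p f₁ f₂ → c₀ ≤ 1 + 3 * a → Ψ₂ + 6 * a ≤ Ψ₁ + 12 * p →
  C₂ + f₁ ≡ C₁ + f₂ → 1 + 12 * p + f₂ ≤ 3 * a + f₁ → c₀ + (Ψ₂ + C₂) ≤ Ψ₁ + C₁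
balance c₀ Ψ₁ Ψ₂ C₁ C₂ a p f₁ f₂ h₁ h₂ h₃ h₄ = ℕ.+-cancelʳ-≤ (3 * a + f₁ + 12 * p + f₂) _ _ (begin
  c₀ + (Ψ₂ + C₂) + (3 * a + f₁ + 12 * p + f₂)
    ≤⟨ ℕ.+-monoˡ-≤ _ (ℕ.+-monoˡ-≤ _ h₁) ⟩
  1 + 3 * a + (Ψ₂ + C₂) + (3 * a + f₁ + 12 * p + f₂)
    ≡⟨ eq₁ Ψ₂ C₂ a p f₁ f₂ ⟩
  (Ψ₂ + 6 * a) + (C₂ + f₁) + (1 + 12 * p + f₂)
    ≤⟨ ℕ.+-mono-≤ (ℕ.+-mono-≤ h₂ (ℕ.≤-reflexive h₃)) h₄ ⟩
  (Ψ₁ + 12 * p) + (C₁ + f₂) + (3 * a + f₁)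
    ≡⟨ eq₂ Ψ₁ C₁ a p f₁ f₂ ⟩
  Ψ₁ + C₁ + (3 * a + f₁ + 12 * p + f₂) ∎)
  where
  open ℕ.≤-Reasoning
  eq₁ : ∀ Ψ C a p f g → 1 + 3 * a + (Ψ + C) + (3 * a + f + 12 * p + g)
                      ≡ (Ψ + 6 * a) + (C + f) + (1 + 12 * p + g)
  eq₁ = solve-∀
  eq₂ : ∀ Ψ C a p f g → (Ψ + 12 * p) + (C + g) + (3 * a + f) ≡ Ψ + C + (3 * a + f + 12 * p + g)
  eq₂ = solve-∀

-- For an action of the schedule: `c` is its cost, or that of the actions after it, and the
-- potential may rise by 24 times the cost of the action.
charge : ∀ x c b p p′ → x ≤ 24 * c + p′ → p′ ≤ 24 * b + p → x ≤ 24 * (b + c) + p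
charge x c b p p′ x≤ p′≤ = begin
  x                        ≤⟨ x≤ ⟩
  24 * c + p′              ≤⟨ ℕ.+-monoʳ-≤ (24 * c) p′≤ ⟩
  24 * c + (24 * b + p)    ≡⟨ regroup c b p ⟩
  24 * (b + c) + p         ∎
  where
  open ℕ.≤-Reasoning
  regroup : ∀ x y z → 24 * x + (24 * y + z) ≡ 24 * (y + x) + z
  regroup = solve-∀

-- For a phase of ALG: its cost `x` is paid by the fall of the potential from `p` to `p′`.
spend : ∀ x y b p p′ → y ≤ b + p′ → x + p′ ≤ p → x + y ≤ b + p
spend x y b p p′ y≤ x≤ = begin
  x + y           ≤⟨ ℕ.+-monoʳ-≤ x y≤ ⟩
  x + (b + p′)    ≡⟨ regroup x b p′ ⟩
  b + (x + p′)    ≤⟨ ℕ.+-monoʳ-≤ b x≤ ⟩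
  b + p           ∎
  where
  open ℕ.≤-Reasoning
  regroup : ∀ x y z → x + (y + z) ≡ y + (x + z)
  regroup = solve-∀

-- Effect of adjacent swaps and of moves to the front on indices.

module Analysis {c ℓ₁ ℓ₂} (Time : DecTotalOrder c ℓ₁ ℓ₂) (n : ℕ) where

  open ListUpdate Time n
  open DecTotalOrder Time using (totalOrder)
    renaming ( Carrier to T; _≤_ to _≤ᵗ_; _≤?_ to _≤?ᵗ_; _≟_ to _≟ᵗ_; refl to ≤ᵗ-refl; trans to ≤ᵗ-trans
             ; reflexive to ≤ᵗ-reflexive)

  -- The graph of the transposition of `k` and `suc k`; matching on it replaces computing with
  -- `transpose` on `Fin`.
  data Adjacent (k a : ℕ) : ℕ → Set where
    up    : a ≡ k → Adjacent k a (suc k)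
    down  : a ≡ suc k → Adjacent k a k
    fixed : a ≢ k → a ≢ suc k → Adjacent k a a

  swap-index : ∀ π k 1+k<n x → Adjacent k (index π x) (index (perform π (swap k 1+k<n)) x)
  swap-index π k 1+k<n x
    with (π ⟨$⟩ʳ x) ≟ fromℕ< (ℕ.<-trans (ℕ.n<1+n k) 1+k<n)
  ... | yes z≡k = subst (Adjacent k _) (sym (toℕ-fromℕ< 1+k<n)) (up (trans (cong toℕ z≡k) (toℕ-fromℕ< _)))
  ... | no z≢k with (π ⟨$⟩ʳ x) ≟ fromℕ< 1+k<n
  ...   | yes z≡1+k = subst (Adjacent k _) (sym (toℕ-fromℕ< (ℕ.<-trans (ℕ.n<1+n k) 1+k<n)))
                            (down (trans (cong toℕ z≡1+k) (toℕ-fromℕ< 1+k<n)))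
  ...   | no z≢1+k  = fixed (λ eq → z≢k (toℕ-injective (trans eq (sym (toℕ-fromℕ< _)))))
                            (λ eq → z≢1+k (toℕ-injective (trans eq (sym (toℕ-fromℕ< 1+k<n)))))

  -- No index lies strictly between `k` and `suc k`, so the exchanged pair is the only one whose
  -- order changes.
  Adjacent-reflects-< : ∀ {k a b a′ b′} → Adjacent k a a′ → Adjacent k b b′ → a′ < b′ →
    a < b ⊎ (a ≡ suc k × b ≡ k)
  Adjacent-reflects-< (up _)       (up _)       lt = contradiction lt (ℕ.<-irrefl refl)
  Adjacent-reflects-< (up _)       (down _)     lt = contradiction lt (ℕ.<-asym (ℕ.n<1+n _))
  Adjacent-reflects-< (up refl)    (fixed _ _)  lt = inj₁ (ℕ.<-trans (ℕ.n<1+n _) lt)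
  Adjacent-reflects-< (down p)     (up q)       lt = inj₂ (p , q)
  Adjacent-reflects-< (down _)     (down _)     lt = contradiction lt (ℕ.<-irrefl refl)
  Adjacent-reflects-< (down refl)  (fixed _ ≢)  lt = inj₁ (ℕ.≤∧≢⇒< lt (≢ ∘ sym))
  Adjacent-reflects-< (fixed ≢ _)  (up refl)    lt = inj₁ (ℕ.≤∧≢⇒< (ℕ.≤-pred lt) ≢)
  Adjacent-reflects-< (fixed _ _)  (down refl)  lt = inj₁ (ℕ.<-trans lt (ℕ.n<1+n _))
  Adjacent-reflects-< (fixed _ _)  (fixed _ _)  lt = inj₁ lt

  Ψ-perform-swap : ∀ π ρ σ k 1+k<n → Ψ π (perform ρ (swap k 1+k<n)) σ ≤ 18 + Ψ π ρ σ
  Ψ-perform-swap π ρ σ k 1+k<n = Ψ-overtake π ρ (perform ρ (swap k 1+k<n)) σ u v pointwise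
    where
    -- The swap moves `u` forward past `v`.
    u = ρ ⟨$⟩ˡ fromℕ< 1+k<n
    v = ρ ⟨$⟩ˡ fromℕ< (ℕ.<-trans (ℕ.n<1+n k) 1+k<n)

    element-at : ∀ {x m} (m<n : m < n) → index ρ x ≡ m → x ≡ ρ ⟨$⟩ˡ fromℕ< m<n
    element-at m<n eq =
      trans (sym (inverseˡ ρ)) (cong (ρ ⟨$⟩ˡ_) (toℕ-injective (trans eq (sym (toℕ-fromℕ< m<n)))))

    pointwise : ∀ x y → before (perform ρ (swap k 1+k<n)) x y ≤ before ρ x y + 𝟙 (x ≟ u) * 𝟙 (y ≟ v)
    pointwise x y = 𝟙≤ (_ ℕ.<? _) λ lt →
      case Adjacent-reflects-< (swap-index ρ k 1+k<n x) (swap-index ρ k 1+k<n y) lt of λ where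
        (inj₁ x<y) → ℕ.≤-trans (ℕ.≤-reflexive (sym (if-yes (_ ℕ.<? _) x<y))) (ℕ.m≤m+n _ _)
        (inj₂ (x≡ , y≡)) →
          ℕ.≤-trans (ℕ.≤-reflexive (sym (cong₂ _*_ (if-yes (x ≟ u) (element-at 1+k<n x≡))
                                                   (if-yes (y ≟ v) (element-at (ℕ.<-trans (ℕ.n<1+n k) 1+k<n) y≡)))))
                    (ℕ.m≤n+m _ _)

  -- The graph of the cycle that takes index `k` to 0 and shifts the smaller indices up by one.
  data Pulled (k a : ℕ) : ℕ → Set where
    to-front : a ≡ k → Pulled k a 0
    delayed  : a < k → Pulled k a (suc a)
    kept     : k < a → Pulled k a a

  pulled-suc : ∀ {k a b c} → Adjacent k a b → Pulled k b c → Pulled (suc k) a c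
  pulled-suc (up refl)       (to-front eq) = contradiction (sym eq) (ℕ.<⇒≢ (ℕ.n<1+n _))
  pulled-suc (up refl)       (delayed lt)  = contradiction lt (ℕ.<-asym (ℕ.n<1+n _))
  pulled-suc (up refl)       (kept _)      = delayed (ℕ.n<1+n _)
  pulled-suc (down eq)       (to-front _)  = to-front eq
  pulled-suc (down _)        (delayed lt)  = contradiction lt (ℕ.<-irrefl refl)
  pulled-suc (down _)        (kept lt)     = contradiction lt (ℕ.<-irrefl refl)
  pulled-suc (fixed ≢k _)    (to-front eq) = contradiction eq ≢k
  pulled-suc (fixed _ _)     (delayed lt)  = delayed (ℕ.m<n⇒m<1+n lt)
  pulled-suc (fixed _ ≢1+k)  (kept lt)     = kept (ℕ.≤∧≢⇒< lt (≢1+k ∘ sym))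

  toFront-index : ∀ k k<n π x → Pulled k (index π x) (index (foldl perform π (toFront k k<n)) x)
  toFront-index (suc k) 1+k<n π x = pulled-suc (swap-index π k 1+k<n x) (toFront-index k _ _ x)
  toFront-index zero    _     π x with index π x in eq
  ... | zero  = to-front refl
  ... | suc _ = kept z<s

  toFront-fronted : ∀ π e → Fronted π (foldl perform π (toFront (index π e) (toℕ<n _))) e
  toFront-fronted π e = record
    { at-front = front (moved e)
    ; delays   = λ x x≢e → later x≢e (moved x)
    ; reflects = λ x y x≢e y≢e → order x≢e y≢e (moved x) (moved y)
    }
    where
    moved = toFront-index (index π e) (toℕ<n _) π

    front : ∀ {b} → Pulled (index π e) (index π e) b → b ≡ 0
    front (to-front _) = refl
    front (delayed lt) = contradiction lt (ℕ.<-irrefl refl)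
    front (kept lt)    = contradiction lt (ℕ.<-irrefl refl)

    later : ∀ {x b} → x ≢ e → Pulled (index π e) (index π x) b → index π x ≤ b
    later x≢e (to-front eq) = contradiction (index-injective π eq) x≢e
    later x≢e (delayed _)   = ℕ.n≤1+n _
    later x≢e (kept _)      = ℕ.≤-refl

    order : ∀ {x y a b} → x ≢ e → y ≢ e → Pulled (index π e) (index π x) a → Pulled (index π e) (index π y) b →
      a < b → index π x < index π y
    order x≢e y≢e (to-front eq) _             _  = contradiction (index-injective π eq) x≢e
    order x≢e y≢e (delayed _)   (to-front eq) _  = contradiction (index-injective π eq) y≢e
    order x≢e y≢e (kept _)      (to-front eq) _  = contradiction (index-injective π eq) y≢e
    order x≢e y≢e (delayed _)   (delayed _)   lt = ℕ.≤-pred lt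
    order x≢e y≢e (delayed _)   (kept _)      lt = ℕ.<-trans (ℕ.n<1+n _) lt
    order x≢e y≢e (kept k<x)    (delayed y<k) lt =
      contradiction (ℕ.<-≤-trans (ℕ.<-trans y<k k<x) (ℕ.≤-pred lt)) (ℕ.<-irrefl refl)
    order x≢e y≢e (kept _)      (kept _)      lt = lt

  cost-toFront : ∀ (t : T) k k<n → cost (map (t ,_) (toFront k k<n)) ≡ k
  cost-toFront t zero    _     = refl
  cost-toFront t (suc k) 1+k<n = cong suc (cost-toFront t k _)

  cost-++ : ∀ S S′ → cost (S ++ S′) ≡ cost S + cost S′
  cost-++ S S′ = trans (cong ListAction.sum (map-++ _ S S′)) (sum-++ (map _ S) _)

  -- The ledger and the actions of the schedule.

  -- accounts lists the arguments (j , m) of φ for the accesses of the schedule so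
  -- far, after a dummy (0 , 0), and account e is the last one that reached e.
  record Ledger : Set where
    field
      snapshot : Vector Ordering n
      {size}   : ℕ
      accounts : Vector (ℕ × ℕ) size
      account  : Fin n → Fin size

    entry : Fin n → ℕ × ℕ
    entry e = accounts (account e)

    credit : ℕ
    credit = ∑[ x < size ] φ (proj₁ (accounts x)) (proj₂ (accounts x))

  open Ledger

  potential : Ledger → Ordering → Ordering → ℕ
  potential L π ρ = Ψ π ρ (snapshot L) + credit L

  -- The account of `e` can pay for a phase triggered by `e`: its access reaches the position of `e`
  -- in the snapshot, and its barrier does not exceed the position of `e` in ALG's list. Such a
  -- phase destroys this for `e`, but it also serves every arrived request for `e`.
  record Located (L : Ledger) (π : Ordering) (e : Fin n) : Set where
    constructor located
    field
      {σ}       : Ordering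
      {j m}     : ℕ
      σ≡        : snapshot L e ≡ σ
      entry≡    : entry L e ≡ (j , m)
      snapshot≤ : position σ e ≤ j
      barrier≤  : m ≤ position π e

  -- The schedule has served r.  Comparing arrivals with the remaining deadlines
  -- ensures that r has arrived by the next phase, whenever that is.
  Settled : Ledger → Ordering → List Request → Request → Set (c ⊔ˡ ℓ₂)
  Settled L π us r = (∀ {r′} → r′ ∈ us → arrival r ≤ᵗ deadline r′) × Located L π (element r)

  Accounted : Ledger → Ordering → Ordering → List Request → Schedule → Request → Set (c ⊔ˡ ℓ₂)
  Accounted L π ρ us S r = ServedInTime r ρ S ⊎ Settled L π us r

  -- A swap raises `Ψ` by at most 18. An access up to `j` only renews snapshots, which cannot raise
  -- `Ψ`, and opens an account with barrier 0, whose credit is at most `24 * j`.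
  optStep : ∀ L π ρ us s a S → (∀ {r} → r ∈ us → s ≤ᵗ deadline r) →
    All (Accounted L π ρ us ((s , a) ∷ S)) us →
    Σ[ L′ ∈ Ledger ] potential L′ π (perform ρ a) ≤ 24 * actionCost a + potential L π ρ ×
                     All (Accounted L′ π (perform ρ a) us S) us
  optStep L π ρ us s (swap k 1+k<n) S _ accounted =
    L , paid , All.map (λ { (inj₁ (there st)) → inj₁ st ; (inj₂ st) → inj₂ st }) accounted
    where
    paid : potential L π (perform ρ (swap k 1+k<n)) ≤ 24 + potential L π ρ
    paid = ℕ.+-monoˡ-≤ (credit L)
      (ℕ.≤-trans (Ψ-perform-swap π ρ (snapshot L) k 1+k<n) (ℕ.+-monoˡ-≤ _ (ℕ.m≤m+n 18 6)))
  optStep L π ρ us s (access j j≤n) S s≤ accounted = L′ , paid , All.map account-for accounted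
    where
    covered? : ∀ e → Dec (position ρ e ≤ j)
    covered? e = position ρ e ℕ.≤? j

    L′ : Ledger
    L′ = record
      { snapshot = λ e → if does (covered? e) then ρ else snapshot L e
      ; accounts = (j , 0) ◂ accounts L
      ; account  = λ e → if does (covered? e) then zero else suc (account L e)
      }

    renewed : ∀ y → snapshot L′ y ≡ ρ ⊎ snapshot L′ y ≡ snapshot L y
    renewed y with covered? y
    ... | yes p≤j = inj₁ (if-yes (covered? y) p≤j)
    ... | no p≰j  = inj₂ (if-no (covered? y) p≰j)

    paid : potential L′ π ρ ≤ 24 * j + potential L π ρ
    paid = begin
      Ψ π ρ (snapshot L′) + (φ j 0 + credit L)  ≤⟨ ℕ.+-mono-≤ (Ψ-snapshot π ρ renewed) (ℕ.+-monoˡ-≤ _ φj0≤) ⟩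
      Ψ π ρ (snapshot L) + (24 * j + credit L)  ≡⟨ regroup (Ψ π ρ (snapshot L)) (24 * j) (credit L) ⟩
      24 * j + potential L π ρ                  ∎
      where
      open ℕ.≤-Reasoning
      φj0≤ : φ j 0 ≤ 24 * j
      φj0≤ = ℕ.⊔-lub ℕ.≤-refl (ℕ.*-monoˡ-≤ j (ℕ.m≤m+n 12 12))
      regroup : ∀ x y z → x + (y + z) ≡ y + (x + z)
      regroup = solve-∀

    reached : ∀ {e} → position ρ e ≤ j → Located L′ π e
    reached {e} p≤j =
      located (if-yes (covered? e) p≤j) (cong (accounts L′) (if-yes (covered? e) p≤j)) p≤j z≤n

    relocate : ∀ {e} → Located L π e → Located L′ π e
    relocate {e} (located σ≡ entry≡ snapshot≤ barrier≤) with covered? e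
    ... | yes p≤j = reached p≤j
    ... | no p≰j  = located
      (trans (if-no (covered? e) p≰j) σ≡)
      (trans (cong (accounts L′) (if-no (covered? e) p≰j)) entry≡)
      snapshot≤ barrier≤

    account-for : ∀ {r} → Accounted L π ρ us ((s , access j j≤n) ∷ S) r → Accounted L′ π ρ us S r
    account-for (inj₁ (there st))           = inj₁ st
    -- A request served now has arrived by `s`, and `s` is at most every remaining deadline.
    account-for (inj₁ (here (a≤s , p≤j) _)) = inj₂ ((λ r′∈ → ≤ᵗ-trans a≤s (s≤ r′∈)) , reached p≤j)
    account-for (inj₂ (arrived , loc))      = inj₂ (arrived , relocate loc)

  -- One phase of ALG.

  module Phase (L : Ledger) (π ρ : Ordering) (r : Request) (rs : List Request) (S : Schedule)
               (accounted : All (Accounted L π ρ (r ∷ rs) S) (r ∷ rs)) where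
    open Step π r rs hiding (i)

    e : Fin n
    e = trigger

    a : ℕ
    a = index π e

    fr : Fronted π π′ e
    fr = toFront-fronted π e

    next≤ : ∀ {r′} → r′ ∈ r ∷ rs → t ≤ᵗ deadline r′
    next≤ = All.lookup (Extrema.f[argmin]≤f[⊤] totalOrder {f = deadline} r rs
                        ∷ Extrema.f[argmin]≤f[xs] totalOrder {f = deadline} r rs)

    triggering : Σ[ r* ∈ Request ] r* ∈ r ∷ rs × element r* ≡ e × deadline r* ≤ᵗ t
    triggering with Extrema.argmax-sel ℕ.≤-totalOrder (position π) (element next) (map element due)
    ... | inj₁ e≡next = next , next-∈ , sym e≡next , ≤ᵗ-refl
    ... | inj₂ e∈due with ∈-map⁻ element e∈due
    ...   | r* , r*∈due , e≡ with ∈-filter⁻ (λ r′ → (arrival r′ ≤?ᵗ t) ×-dec (deadline r′ ≟ᵗ t)) r*∈due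
    ...     | r*∈ , _ , d≈t = r* , r*∈ , sym e≡ , ≤ᵗ-reflexive d≈t

    unserved⁻ : ∀ {r′} → r′ ∈ unserved → r′ ∈ r ∷ rs × ¬ Reaches t π reach r′
    unserved⁻ = ∈-filter⁻ (∁? (reaches? t π reach))

    cost-phase : cost (map (t ,_) actions) ≤ 1 + 3 * a
    cost-phase = begin
      reach + cost (map (t ,_) (toFront a (toℕ<n (π ⟨$⟩ʳ e))))
        ≡⟨ cong (reach +_) (cost-toFront t a _) ⟩
      reach + a
        ≤⟨ ℕ.+-monoˡ-≤ a (ℕ.m⊓n≤m (2 * suc a ∸ 1) n) ⟩
      a + suc (a + 0) + a
        ≡⟨ eq a ⟩
      1 + 3 * a ∎
      where
      open ℕ.≤-Reasoning
      eq : ∀ a → a + (1 + (a + 0)) + a ≡ 1 + 3 * a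
      eq = solve-∀

    -- This gives the doubling of positions: an arrived request that survives lies past the first
    -- `2 * suc a ∸ 1` positions. If the access covers the whole list, no arrived request survives.
    beyond : ∀ {r′} → r′ ∈ unserved → arrival r′ ≤ᵗ t → 2 * suc a ≤ position π (element r′)
    beyond {r′} r′∈ a≤t with unserved⁻ r′∈
    ... | _ , ¬reached with ℕ.≤-total (2 * suc a ∸ 1) n
    ...   | inj₁ ≤n = ℕ.≰⇒> λ p≤ → ¬reached (a≤t , ℕ.≤-trans p≤ (ℕ.≤-reflexive (sym (ℕ.m≤n⇒m⊓n≡m ≤n))))
    ...   | inj₂ n≤ = contradiction
              (a≤t , ℕ.≤-trans (toℕ<n _) (ℕ.≤-reflexive (sym (ℕ.m≥n⇒m⊓n≡n n≤)))) ¬reached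

    unserved-elsewhere : ∀ {r′} → r′ ∈ unserved → arrival r′ ≤ᵗ t → element r′ ≢ e
    unserved-elsewhere r′∈ a≤t eq = proj₂ (unserved⁻ r′∈)
      (a≤t , ℕ.≤-trans (ℕ.≤-reflexive (cong (position π) eq)) i≤reach)

    module Settlement (trigger-located : Located L π e) where
      open Located trigger-located

      k : Fin (size L)
      k = account L e

      L′ : Ledger
      L′ = record
        { snapshot = updateAt (snapshot L) e (const ρ)
        -- The reach `j` stays, and the barrier rises to twice the position of `e`.
        ; accounts = updateAt (accounts L) k (const (j , 2 * suc a))
        ; account  = account L
        }

      common : ℕ
      common = ∑[ x < n ] before π x e * before (snapshot L e) x e

      credit′ : credit L′ + φ j m ≡ credit L + φ j (2 * suc a)
      credit′ = trans (cong (λ b → credit L′ + φ (proj₁ b) (proj₂ b)) (sym entry≡))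
                      (∑-updateAt (λ b → φ (proj₁ b) (proj₂ b)) (accounts L) k (j , 2 * suc a))

      common≤a : common ≤ a
      common≤a = ℕ.≤-trans
        (∑-mono (λ x → ℕ.≤-trans (ℕ.*-monoʳ-≤ (before π x e) (before≤1 (snapshot L e) x e))
                                 (ℕ.≤-reflexive (ℕ.*-identityʳ _))))
        (ℕ.≤-reflexive (∑-before π e))

      -- In the snapshot `e` is among the first `j` positions, so fewer than `j` elements precede it
      -- there.
      common<j : common < j
      common<j = ℕ.≤-<-trans
        (∑-mono (λ x → ℕ.≤-trans (ℕ.*-monoˡ-≤ (before (snapshot L e) x e) (before≤1 π x e))
                                 (ℕ.≤-reflexive (ℕ.*-identityˡ _))))
        (ℕ.≤-<-trans (ℕ.≤-reflexive (∑-before (snapshot L e) e)) (subst (λ τ → position τ e ≤ j) (sym σ≡) snapshot≤))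

      paid : cost (map (t ,_) actions) + potential L′ π′ ρ ≤ potential L π ρ
      paid = balance (cost (map (t ,_) actions)) (Ψ π ρ (snapshot L)) (Ψ π′ ρ (snapshot L′)) (credit L) (credit L′)
        a common (φ j m) (φ j (2 * suc a))
        cost-phase (Ψ-front fr ρ (snapshot L)) credit′ (φ-pays barrier≤ common≤a common<j)

      module Relocated {r′ σ′} (r′∈ : r′ ∈ unserved) (a≤t : arrival r′ ≤ᵗ t)
                       (σ′≡ : snapshot L (element r′) ≡ σ′) where

        elsewhere : element r′ ≢ e
        elsewhere = unserved-elsewhere r′∈ a≤t

        relocated : ∀ {j′ m′} → entry L′ (element r′) ≡ (j′ , m′) → position σ′ (element r′) ≤ j′ →
          m′ ≤ position π (element r′) → Located L′ π′ (element r′)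
        relocated entry′≡ snapshot≤′ barrier≤′ = located
          (trans (updateAt-minimal (element r′) e (snapshot L) elsewhere) σ′≡)
          entry′≡ snapshot≤′
          (ℕ.≤-trans barrier≤′ (s≤s (Fronted.delays fr (element r′) elsewhere)))

      -- Elements other than `e` never move forward, so unchanged barriers stay valid. For an
      -- element sharing the account of `e`, the raised barrier is justified by `beyond`, and the
      -- reach is the same `j`.
      relocate : ∀ {r′} → r′ ∈ unserved → arrival r′ ≤ᵗ t → Located L π (element r′) → Located L′ π′ (element r′)
      relocate {r′} r′∈ a≤t (located σ′≡ entry′≡ snapshot≤′ barrier≤′)
        with account L (element r′) ≟ k
      ... | no ≢k = relocated (trans (updateAt-minimal _ k (accounts L) ≢k) entry′≡) snapshot≤′ barrier≤′
        where open Relocated r′∈ a≤t σ′≡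
      ... | yes ≡k = relocated
        (trans (cong (accounts L′) ≡k) (updateAt-updates k (accounts L)))
        (ℕ.≤-trans snapshot≤′
          (ℕ.≤-reflexive (cong proj₁ (trans (sym entry′≡) (trans (cong (accounts L) ≡k) entry≡)))))
        (beyond r′∈ a≤t)
        where open Relocated r′∈ a≤t σ′≡

      account-for : ∀ {r′} → r′ ∈ unserved → Accounted L π ρ (r ∷ rs) S r′ → Accounted L′ π′ ρ unserved S r′
      account-for r′∈ (inj₁ st)              = inj₁ st
      account-for r′∈ (inj₂ (arrived , loc)) =
        -- As `next` is among the requests, its deadline `t` bounds the arrival of `r′`.
        inj₂ (arrived ∘ proj₁ ∘ unserved⁻ , relocate r′∈ (arrived next-∈) loc)

    -- The triggering request is due by `t` and the rest of the schedule is too late for it, so it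
    -- has been served already and `e` has a usable account.
    trigger-located : (∀ {r*} → r* ∈ r ∷ rs → deadline r* ≤ᵗ t → ¬ ServedInTime r* ρ S) → Located L π e
    trigger-located too-late with triggering
    ... | r* , r*∈ , e≡ , d≤t with All.lookup accounted r*∈
    ...   | inj₁ st        = contradiction st (too-late r*∈ d≤t)
    ...   | inj₂ (_ , loc) = subst (Located L π) e≡ loc

    step : (∀ {r*} → r* ∈ r ∷ rs → deadline r* ≤ᵗ t → ¬ ServedInTime r* ρ S) →
      Σ[ L′ ∈ Ledger ] cost (map (t ,_) actions) + potential L′ π′ ρ ≤ potential L π ρ ×
                       All (Accounted L′ π′ ρ unserved S) unserved
    step too-late =
      L′ , paid , All.tabulate (λ r′∈ → account-for r′∈ (All.lookup accounted (proj₁ (unserved⁻ r′∈))))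
      where open Settlement (trigger-located too-late)

  -- Merging the two runs in time order.

  head≤deadline : ∀ {r ρ s b S} → Linked (_≤ᵗ_ on proj₁) ((s , b) ∷ S) → ServedInTime r ρ ((s , b) ∷ S) →
    s ≤ᵗ deadline r
  head≤deadline _         (here _ s≤d)          = s≤d
  -- Splitting `st` excludes an empty remainder, so a second action exists to compare with.
  head≤deadline (s≤s′ ∷ l) (there st@(here _ _)) = ≤ᵗ-trans s≤s′ (head≤deadline l st)
  head≤deadline (s≤s′ ∷ l) (there st@(there _))  = ≤ᵗ-trans s≤s′ (head≤deadline l st)

  -- Shared by both places where ALG acts next. The bound on the remaining run is an argument, so
  -- the recursion itself stays in `runFrom≤`.
  phase≤ : ∀ L π ρ r rs (rec : ∀ {m} → m < length (r ∷ rs) → Acc _<_ m) S →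
    (∀ {r*} → r* ∈ r ∷ rs → deadline r* ≤ᵗ Step.t π r rs → ¬ ServedInTime r* ρ S) →
    All (Accounted L π ρ (r ∷ rs) S) (r ∷ rs) →
    (let open Step π r rs in
      ∀ L′ → All (Accounted L′ π′ ρ unserved S) unserved →
      cost (runFrom π′ unserved (rec unserved-<)) ≤ 24 * cost S + potential L′ π′ ρ) →
    cost (runFrom π (r ∷ rs) (acc rec)) ≤ 24 * cost S + potential L π ρ
  phase≤ L π ρ r rs rec S too-late accounted rest≤ =
    let L′ , paid , accounted′ = Phase.step L π ρ r rs S accounted too-late in
    ℕ.≤-trans (ℕ.≤-reflexive (cost-++ (map (t ,_) actions) (runFrom π′ unserved (rec unserved-<))))
      (spend (cost (map (t ,_) actions)) (cost (runFrom π′ unserved (rec unserved-<))) (24 * cost S)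
        (potential L π ρ) (potential L′ π′ ρ) (rest≤ L′ accounted′) paid)
    where open Step π r rs

  -- An action of the schedule at time `s` precedes a phase at time `t` when `s ≤ᵗ t`. With ties
  -- resolved this way, all actions left at a phase come after `t` and cannot serve a request due by
  -- `t`. Each step shortens `S` or the list of unserved requests.
  runFrom≤ : ∀ L π ρ us (ac : Acc _<_ (length us)) S → Linked (_≤ᵗ_ on proj₁) S →
    All (Accounted L π ρ us S) us → cost (runFrom π us ac) ≤ 24 * cost S + potential L π ρ
  runFrom≤ L π ρ []       _         S  _ _ = z≤n
  runFrom≤ L π ρ (r ∷ rs) (acc rec) [] l accounted =
    phase≤ L π ρ r rs rec [] (λ _ _ ()) accounted
      (λ L′ → runFrom≤ L′ _ ρ _ (rec (Step.unserved-< π r rs)) [] l)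
  runFrom≤ L π ρ (r ∷ rs) (acc rec) ((s , b) ∷ S) l accounted =
    [ (λ s≤t →
        let L′ , paid , accounted′ =
              optStep L π ρ (r ∷ rs) s b S (λ r′∈ → ≤ᵗ-trans s≤t (Phase.next≤ L π ρ r rs _ accounted r′∈)) accounted in
        charge (cost (runFrom π (r ∷ rs) (acc rec))) (cost S) (actionCost b)
          (potential L π ρ) (potential L′ π (perform ρ b))
          (runFrom≤ L′ π (perform ρ b) (r ∷ rs) (acc rec) S (Linked.tail l) accounted′) paid)
    , (λ s≰t →
        phase≤ L π ρ r rs rec ((s , b) ∷ S) (λ _ d≤t st → s≰t (≤ᵗ-trans (head≤deadline l st) d≤t)) accounted
          (λ L′ → runFrom≤ L′ _ ρ _ (rec (Step.unserved-< π r rs)) ((s , b) ∷ S) l))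
    ]′ (toSum (s ≤?ᵗ Step.t π r rs))

  ALG≤24cost : ∀ π₀ σ S → Feasible π₀ σ S → ALG π₀ σ ≤ 24 * cost S
  ALG≤24cost π₀ σ S (l , served) = begin
    ALG π₀ σ                       ≤⟨ runFrom≤ L₀ π₀ π₀ σ (<-wellFounded _) S l (All.map inj₁ served) ⟩
    24 * cost S + potential L₀ π₀ π₀
                                   ≡⟨ cong (24 * cost S +_) (trans (ℕ.+-identityʳ _) (Ψ-refl π₀)) ⟩
    24 * cost S + 0                ≡⟨ ℕ.+-identityʳ _ ⟩
    24 * cost S                    ∎
    where
    open ℕ.≤-Reasoning
    L₀ : Ledger
    -- The dummy account only makes `account` total: its credit is 0, and no element is `Located` on
    -- it since positions start at 1.
    L₀ = record { snapshot = const π₀ ; size = 1 ; accounts = const (0 , 0) ; account = const zero }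

theorem1 : ∀ {c ℓ₁ ℓ₂} (Time : DecTotalOrder c ℓ₁ ℓ₂) (n : ℕ) →
    let open ListUpdate Time n in
    (π₀ : Ordering) (σ : List Request) (opt : ℕ) →
    IsOPT π₀ σ opt → ALG π₀ σ ≤ 24 * opt
theorem1 Time n π₀ σ _ ((S , feasible , refl) , _) = Analysis.ALG≤24cost Time n π₀ σ S feasible
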